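{- Let $B=\{100,012\}$, and for $m\ge1$ let $\mathcal T_m$ be the generating tree for all inversion sequences of the form $\pi=0^mm\pi'$ that avoid $B$ (i.e. the plane tree $\mathcal T(B;0^mm)$). Then the generating tree $\mathcal T[B]$ is given by $$\text{Root: } a_1,\qquad \text{Rules: } a_m\rightsquigarrow a_{m+1},\mathcal T_1,\mathcal T_2,\ldots,\mathcal T_m \quad (m\ge1),$$ where $a_m=0^m$. That is, the root is labelled $a_1$, and a node labelled $a_m$ has exactly $m+1$ children, the subtrees at which are, from left to right and up to plane tree isomorphism, the subtree of a node labelled $a_{m+1}$ followed by $\mathcal T_1,\mathcal T_2,\dots,\mathcal T_m$.
   Context: For $n\ge 0$, $I_n$ denotes the set of inversion sequences $e=e_0e_1\cdots e_n$, i.e. integer sequences with $0\le e_i\le i$ for each $0\le i\le n$. An inversion sequence contains a pattern $\tau$ if it has a (not necessarily consecutive) subsequence order isomorphic to $\tau$ (including equalities); otherwise it avoids $\tau$. $I_n(B)$ is the set of $e\in I_n$ avoiding all patterns in $B$. $\mathcal T(B)$ is the rooted plane tree with root $0$ whose level-$n$ nodes are the elements of $I_n(B)$ (root at level 0), where the parent of $e_0\cdots e_n$ is $e_0\cdots e_{n-1}$ and siblings are ordered left to right by increasing last letter. For a node $e$, $\mathcal T(B;e)$ is the plane subtree consisting of $e$ and its descendants. Nodes $v,w$ are equivalent, $v\sim w$, if $\mathcal T(B;v)\cong\mathcal T(B;w)$ as plane trees. $\mathcal T[B]$ is the tree $\mathcal T(B)$ in which each node is relabelled by the representative of its equivalence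 class, namely the left-most node at the lowest-numbered level in the class. Here $0^m$ is the word of $m$ zeros and $0^mm$ is $0^m$ followed by the letter $m$. -}

module Defs where

open import Data.Fin as Fin using (Fin; toℕ)
open import Data.Irrelevant using ([_])
open import Data.List using (List; []; _∷_; _∷ʳ_; length; lookup; replicate)
open import Data.List.Properties using (length-++; length-replicate)
open import Data.List.Relation.Unary.All using (All; []; _∷_)
open import Data.Nat using (ℕ; zero; suc; pred; _+_; _≤_; _<_; z≤n; s≤s; NonZero)
open import Data.Nat.Properties using (≤-refl; ≤-reflexive; ≤-trans; n≤1+n; +-comm; +-suc)
open import Data.Product using (Σ; ∃-syntax; _×_; _,_)
open import Data.Refinement using (Refinement-syntax; value; _,_)
open import Data.Sum using (_⊎_)
open import Function using (_⇔_; _↔_; Equivalence; Inverse)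
open import Relation.Binary.Construct.Closure.ReflexiveTransitive using (Star; ε)
open import Relation.Binary.PropositionalEquality
  using (_≡_; refl; sym; trans; cong; subst)
open import Relation.Nullary using (¬_)

Word : Set
Word = List ℕ

-- Indices start at 0, so the elements of Iₙ have n + 1 letters.
IsInversionSequence : ℕ → Word → Set
IsInversionSequence n e =
  length e ≡ suc n × (∀ (i : Fin (length e)) → lookup e i ≤ toℕ i)

-- Preserving and reflecting ≤ for all ordered pairs of positions preserves and
-- reflects < and ≡ as well.
Contains : Word → Word → Set
Contains τ e =
  Σ (Fin (length τ) → Fin (length e)) λ φ →
    (∀ i j → i Fin.< j → φ i Fin.< φ j) ×
    (∀ i j → (lookup τ i ≤ lookup τ j) ⇔ (lookup e (φ i) ≤ lookup e (φ j)))

Avoids : Word → Word → Set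
Avoids τ e = ¬ Contains τ e

-- Iₙ(B)
_∈I_[_] : Word → ℕ → List Word → Set
e ∈I n [ B ] = IsInversionSequence n e × All (λ τ → Avoids τ e) B

-- The root, the parent-child relation and the left-to-right order of siblings.
-- Plane trees may be infinite.
record RawPlaneTree : Set₁ where
  field
    Node        : Set
    root        : Node
    _ParentOf_  : Node → Node → Set
    _LeftSibOf_ : Node → Node → Set

record _≅_ (S T : RawPlaneTree) : Set where
  private
    module S = RawPlaneTree S
    module T = RawPlaneTree T
  field
    bijection : S.Node ↔ T.Node
  open Inverse bijection public using (to; from)
  field
    to-root    : to S.root ≡ T.root
    to-parent  : ∀ v w → (v S.ParentOf w) ⇔ (to v T.ParentOf to w)
    to-leftSib : ∀ v w → (v S.LeftSibOf w) ⇔ (to v T.LeftSibOf to w)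

module GeneratingTree (B : List Word) where

  -- The refinement makes membership proof-irrelevant: nodes are equal as soon
  -- as the underlying words are.
  Node : Set
  Node = [ e ∈ Word ∣ (∃[ n ] e ∈I n [ B ]) ]

  level : Node → ℕ
  level v = pred (length (value v))

  _ParentOf_by_ : Node → Node → ℕ → Set
  v ParentOf w by x = value w ≡ value v ∷ʳ x

  _ParentOf_ : Node → Node → Set
  v ParentOf w = ∃[ x ] v ParentOf w by x

  _LeftSibOf_ : Node → Node → Set
  v LeftSibOf w =
    ∃[ p ] ∃[ x ] ∃[ y ] p ParentOf v by x × p ParentOf w by y × x < y

  -- w is v or a descendant of v.
  _AncestorOf_ : Node → Node → Set
  _AncestorOf_ = Star _ParentOf_

  -- The left-to-right order on the nodes of a level: u and w lie below
  -- siblings p and q, with p to the left of q.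
  _LeftOf_ : Node → Node → Set
  u LeftOf w =
    ∃[ p ] ∃[ q ] p LeftSibOf q × p AncestorOf u × q AncestorOf w

  -- 𝒯(B; v); the whole tree 𝒯(B) is the case where v is the node 0.
  𝒯 : Node → RawPlaneTree
  𝒯 v = record
    { Node        = [ w ∈ Node ∣ v AncestorOf w ]
    ; root        = v , [ ε ]
    ; _ParentOf_  = λ u w → value u ParentOf value w
    ; _LeftSibOf_ = λ u w → value u LeftSibOf value w
    }

  _∼_ : Node → Node → Set
  v ∼ w = 𝒯 v ≅ 𝒯 w

  -- v carries the label r in 𝒯[B]: r is the left-most node at the
  -- lowest-numbered level in the class of v.  This is a relation because
  -- computing the representative would require deciding ∼.
  _HasLabel_ : Node → Node → Set
  v HasLabel r =
    r ∼ v ×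
    (∀ u → u ∼ v →
       level r < level u ⊎ (level r ≡ level u × (r ≡ u ⊎ r LeftOf u)))

  -- c lists the children of v, all of them and from left to right.
  ChildrenInOrder : ∀ {k} → Node → (Fin k → Node) → Set
  ChildrenInOrder v c =
    (∀ i → v ParentOf c i) ×
    (∀ w → v ParentOf w → ∃[ i ] c i ≡ w) ×
    (∀ i j → i Fin.< j → c i LeftSibOf c j)

B₀ : List Word
B₀ = (1 ∷ 0 ∷ 0 ∷ []) ∷ (0 ∷ 1 ∷ 2 ∷ []) ∷ []

open GeneratingTree B₀ public

0^ : ℕ → Word
0^ m = replicate m 0

private
  -- Words whose letters other than the last are all 0.
  ZeroBeforeLast : Word → Set
  ZeroBeforeLast e = ∀ (i j : Fin (length e)) → i Fin.< j → lookup e i ≡ 0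

  0^-zeroBeforeLast : ∀ m → ZeroBeforeLast (0^ m)
  0^-zeroBeforeLast (suc m) Fin.zero    j           _         = refl
  0^-zeroBeforeLast (suc m) (Fin.suc i) (Fin.suc j) (s≤s i<j) =
    0^-zeroBeforeLast m i j i<j

  0^∷ʳ-zeroBeforeLast : ∀ m x → ZeroBeforeLast (0^ m ∷ʳ x)
  0^∷ʳ-zeroBeforeLast zero    x Fin.zero    Fin.zero    ()
  0^∷ʳ-zeroBeforeLast (suc m) x Fin.zero    j           _         = refl
  0^∷ʳ-zeroBeforeLast (suc m) x (Fin.suc i) (Fin.suc j) (s≤s i<j) =
    0^∷ʳ-zeroBeforeLast m x i j i<j

  avoids-B₀ : ∀ e → ZeroBeforeLast e → All (λ τ → Avoids τ e) B₀
  avoids-B₀ e zbl = avoids-100 ∷ avoids-012 ∷ []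
    where
    i₀ i₁ i₂ : Fin 3
    i₀ = Fin.zero
    i₁ = Fin.suc Fin.zero
    i₂ = Fin.suc (Fin.suc Fin.zero)

    avoids-100 : Avoids (1 ∷ 0 ∷ 0 ∷ []) e
    avoids-100 (φ , mono , iso)
      with Equivalence.from (iso i₀ i₁)
             (subst (_≤ lookup e (φ i₁))
                    (sym (zbl (φ i₀) (φ i₁) (mono i₀ i₁ (s≤s z≤n)))) z≤n)
    ... | ()

    avoids-012 : Avoids (0 ∷ 1 ∷ 2 ∷ []) e
    avoids-012 (φ , mono , iso)
      with Equivalence.from (iso i₁ i₀)
             (subst (_≤ lookup e (φ i₀))
                    (sym (zbl (φ i₁) (φ i₂) (mono i₁ i₂ (s≤s (s≤s z≤n))))) z≤n)
    ... | ()

  0^-bounded : ∀ m (i : Fin (length (0^ m))) → lookup (0^ m) i ≤ toℕ i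
  0^-bounded (suc m) Fin.zero    = z≤n
  0^-bounded (suc m) (Fin.suc i) = ≤-trans (0^-bounded m i) (n≤1+n (toℕ i))

  0^∷ʳ-bounded : ∀ m x k → x ≤ k + m → (i : Fin (length (0^ m ∷ʳ x))) →
                 lookup (0^ m ∷ʳ x) i ≤ k + toℕ i
  0^∷ʳ-bounded zero    x k x≤ Fin.zero    = x≤
  0^∷ʳ-bounded (suc m) x k x≤ Fin.zero    = z≤n
  0^∷ʳ-bounded (suc m) x k x≤ (Fin.suc i) =
    ≤-trans (0^∷ʳ-bounded m x (suc k) (≤-trans x≤ (≤-reflexive (+-suc k m))) i)
            (≤-reflexive (sym (+-suc k (toℕ i))))

0^∈I : ∀ m → 0^ (suc m) ∈I m [ B₀ ]
0^∈I m =
  (length-replicate (suc m) , 0^-bounded (suc m)) ,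
  avoids-B₀ (0^ (suc m)) (0^-zeroBeforeLast (suc m))

0^mm∈I : ∀ m → (0^ m ∷ʳ m) ∈I m [ B₀ ]
0^mm∈I m =
  ( trans (length-++ (0^ m)) (trans (+-comm (length (0^ m)) 1)
      (cong suc (length-replicate m)))
  , 0^∷ʳ-bounded m m 0 ≤-refl) ,
  avoids-B₀ (0^ m ∷ʳ m) (0^∷ʳ-zeroBeforeLast m m)

rootNode : Node
rootNode = (0 ∷ []) , [ 0 , 0^∈I 0 ]

a : (m : ℕ) → .{{NonZero m}} → Node
a (suc m) = 0^ (suc m) , [ m , 0^∈I m ]

𝒯ₘ : (m : ℕ) → .{{NonZero m}} → RawPlaneTree
𝒯ₘ m = 𝒯 ((0^ m ∷ʳ m) , [ m , 0^mm∈I m ])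

{-# OPTIONS --safe #-}
module Submission where

-- The descendants of 0^m j with 1 ≤ j ≤ m are words 0^m j π, and the number of
-- leading zeros does not matter as long as m ≥ j.  On the one hand, 100 and 012
-- never use two of the leading zeros, because the first letter of each pattern
-- occurs only once in it (contains-merge); so avoidance does not depend on the
-- value of m ≥ 1.  On the other hand, 0 j x with x > j is a copy of 012, so every
-- letter of π is at most j, and the bounds defining an inversion sequence hold
-- beyond the leading zeros as soon as m ≥ j.  Prepending zeros is therefore an
-- isomorphism from 𝒯(0^j j) to 𝒯(0^m j) (child-≅).  This identifies the subtrees
-- at the last m of the m + 1 children 0^m 0, 0^m 1, ..., 0^m m of 0^m.
--
-- The word 0^m represents its own class (a-minimal): a node of level k has at
-- most k + 2 children, one for each letter up to k + 1, so a node with as many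
-- children as 0^m has level at least m - 1; and 0^m is the left-most node of
-- level m - 1.  Finally, an arbitrary node v with label a_m has a subtree
-- isomorphic to 𝒯(0^m), and an isomorphism carries the children of 0^m, their
-- order and the subtrees below them over to v (restrict).

open import Defs
open import Data.Empty using (⊥-elim; ⊥-elim-irr)
open import Data.Fin as Fin using (Fin; zero; suc; toℕ; fromℕ<; pinch)
open import Data.Fin.Properties
  using (injective⇒≤; toℕ-fromℕ<; fromℕ<-injective; toℕ-injective; toℕ≤pred[n])
open import Data.Irrelevant using ([_])
open import Data.List using ([]; _∷_; _∷ʳ_; _++_; drop; length; lookup)
open import Data.List.Properties
  using (≡-dec; ∷-injectiveʳ; ∷ʳ-injectiveʳ; ∷ʳ-++; ++-identityʳ; length-++;
         length-replicate)
open import Data.List.Relation.Unary.All using ([]; _∷_)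
open import Data.Nat
  using (ℕ; zero; suc; pred; _+_; _∸_; _≤_; _<_; z≤n; s≤s; s≤s⁻¹; NonZero)
open import Data.Nat.Properties
  using (≤-refl; ≤-reflexive; ≤-trans; ≤-antisym; pred-mono-≤; n≤1+n; n≤0⇒n≡0;
         m≤n+m; m≤m+n; ≰⇒>; <⇒≱; <⇒≤; +-identityʳ; +-suc; m∸n+n≡m;
         m≤n⇒m<n∨m≡n; _≤?_; _≟_)
open import Data.Product using (Σ; ∃-syntax; _×_; _,_; proj₁; proj₂)
open import Data.Refinement using (value; _,_)
open import Data.Sum using (_⊎_; inj₁; inj₂)
open import Function
  using (_⇔_; _∘_; case_of_; Equivalence; Inverse; mk⇔; mk↔ₛ′)
open import Function.Properties.Equivalence
  using () renaming (refl to ⇔-refl; trans to ⇔-trans)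
open import Function.Properties.Inverse using (↔-refl; ↔-sym; ↔-trans)
open import Relation.Binary.Construct.Closure.ReflexiveTransitive
  using (ε; _◅_; _◅◅_)
open import Relation.Binary.PropositionalEquality
  using (_≡_; _≢_; refl; sym; trans; cong; subst; subst₂)
open import Relation.Nullary using (¬_; yes; no; recompute)

-- Isomorphisms of plane trees

≅-refl : ∀ {S} → S ≅ S
≅-refl {S} = record
  { bijection  = ↔-refl
  ; to-root    = refl
  ; to-parent  = λ _ _ → ⇔-refl
  ; to-leftSib = λ _ _ → ⇔-refl
  }

≅-sym : ∀ {S T} → S ≅ T → T ≅ S
≅-sym {S} {T} f = record
  { bijection  = ↔-sym bijection
  ; to-root    = trans (cong from (sym to-root)) (strictlyInverseʳ S.root)
  ; to-parent  = λ v w → swap S._ParentOf_ T._ParentOf_ to-parent v w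
  ; to-leftSib = λ v w → swap S._LeftSibOf_ T._LeftSibOf_ to-leftSib v w
  }
  where
  module S = RawPlaneTree S
  module T = RawPlaneTree T
  open _≅_ f
  open Inverse bijection using (strictlyInverseˡ; strictlyInverseʳ)
  swap : (R : S.Node → S.Node → Set) (R′ : T.Node → T.Node → Set) →
         (∀ v w → R v w ⇔ R′ (to v) (to w)) →
         ∀ v w → R′ v w ⇔ R (from v) (from w)
  swap R R′ e v w = mk⇔
    (λ r → Equivalence.from (e (from v) (from w))
             (subst₂ R′ (sym (strictlyInverseˡ v)) (sym (strictlyInverseˡ w)) r))
    (λ r → subst₂ R′ (strictlyInverseˡ v) (strictlyInverseˡ w)
             (Equivalence.to (e (from v) (from w)) r))

≅-trans : ∀ {S T U} → S ≅ T → T ≅ U → S ≅ U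
≅-trans f g = record
  { bijection  = ↔-trans f.bijection g.bijection
  ; to-root    = trans (cong g.to f.to-root) g.to-root
  ; to-parent  = λ v w → ⇔-trans (f.to-parent v w) (g.to-parent (f.to v) (f.to w))
  ; to-leftSib = λ v w → ⇔-trans (f.to-leftSib v w) (g.to-leftSib (f.to v) (f.to w))
  }
  where
  module f = _≅_ f
  module g = _≅_ g

-- Containment of patterns

-- An occurrence is transported by any map of positions that preserves letters
-- and the order of the positions used.
contains-map : ∀ τ e e′ (c : Contains τ e) (κ : Fin (length e) → Fin (length e′)) →
               (∀ i → lookup e i ≡ lookup e′ (κ i)) →
               (∀ i j → i Fin.< j → κ (proj₁ c i) Fin.< κ (proj₁ c j)) →
               Contains τ e′
contains-map τ e e′ (φ , _ , iso) κ same mono =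
  (κ ∘ φ) , mono ,
  λ i j → subst₂ (λ x y → (lookup τ i ≤ lookup τ j) ⇔ (x ≤ y))
                 (same (φ i)) (same (φ j)) (iso i j)

contains-∷ : ∀ τ x e → Contains τ e → Contains τ (x ∷ e)
contains-∷ τ x e c@(_ , mono , _) =
  contains-map τ e (x ∷ e) c suc (λ _ → refl) (λ i j i<j → s≤s (mono i j i<j))

-- If the first letter of a pattern occurs only once in it, then no occurrence
-- uses two initial copies of a letter x: they would match the first letter of
-- the pattern and an equal one.
contains-merge : ∀ t τ x w → (∀ j → t ≢ lookup τ j) →
                 Contains (t ∷ τ) (x ∷ x ∷ w) → Contains (t ∷ τ) (x ∷ w)
contains-merge t τ x w once c@(φ , mono , iso) =
  contains-map (t ∷ τ) (x ∷ x ∷ w) (x ∷ w) c (pinch zero) same mono′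
  where
  same : ∀ i → lookup (x ∷ x ∷ w) i ≡ lookup (x ∷ w) (pinch zero i)
  same zero    = refl
  same (suc i) = refl

  pinch-mono : ∀ (p q : Fin (length (x ∷ x ∷ w))) → p Fin.< q →
               ¬ (p ≡ zero × q ≡ suc zero) → pinch zero p Fin.< pinch zero q
  pinch-mono zero    (suc zero)    _   h = ⊥-elim (h (refl , refl))
  pinch-mono zero    (suc (suc q)) _   _ = s≤s z≤n
  pinch-mono (suc p) (suc q)       p<q _ = s≤s⁻¹ p<q

  not-both : ∀ i j → i Fin.< j → ¬ (φ i ≡ zero × φ j ≡ suc zero)
  not-both zero (suc j) _ (eq , eq′) =
    once j (≤-antisym (Equivalence.from (iso zero (suc j)) (≤-reflexive letter≡))
                      (Equivalence.from (iso (suc j) zero) (≤-reflexive (sym letter≡))))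
    where
    letter≡ : lookup (x ∷ x ∷ w) (φ zero) ≡ lookup (x ∷ x ∷ w) (φ (suc j))
    letter≡ = trans (cong (lookup (x ∷ x ∷ w)) eq)
                    (sym (cong (lookup (x ∷ x ∷ w)) eq′))
  not-both (suc i) _ _ (eq , _)
    with subst (φ zero Fin.<_) eq (mono zero (suc i) (s≤s z≤n))
  ... | ()

  mono′ : ∀ i j → i Fin.< j → pinch zero (φ i) Fin.< pinch zero (φ j)
  mono′ i j i<j = pinch-mono (φ i) (φ j) (mono i j i<j) (not-both i j i<j)

contains-012 : ∀ j π (i : Fin (length π)) → 0 < j → j < lookup π i →
               Contains (0 ∷ 1 ∷ 2 ∷ []) (0 ∷ j ∷ π)
contains-012 j π i 0<j j<x = φ , mono , iso
  where
  φ : Fin 3 → Fin (length (0 ∷ j ∷ π))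
  φ zero             = zero
  φ (suc zero)       = suc zero
  φ (suc (suc zero)) = suc (suc i)

  mono : ∀ k l → k Fin.< l → φ k Fin.< φ l
  mono zero             (suc zero)       _ = s≤s z≤n
  mono zero             (suc (suc zero)) _ = s≤s z≤n
  mono (suc zero)       (suc (suc zero)) _ = s≤s (s≤s z≤n)
  mono (suc zero)       (suc zero)       (s≤s ())
  mono (suc (suc zero)) (suc zero)       (s≤s ())
  mono (suc (suc zero)) (suc (suc zero)) (s≤s (s≤s ()))

  both : ∀ {p q r s} → p ≤ q → r ≤ s → (p ≤ q) ⇔ (r ≤ s)
  both x y = mk⇔ (λ _ → y) (λ _ → x)

  neither : ∀ {p q r s} → q < p → s < r → (p ≤ q) ⇔ (r ≤ s)
  neither x y = mk⇔ (λ z → ⊥-elim (<⇒≱ x z)) (λ z → ⊥-elim (<⇒≱ y z))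

  iso : ∀ k l → (lookup (0 ∷ 1 ∷ 2 ∷ []) k ≤ lookup (0 ∷ 1 ∷ 2 ∷ []) l) ⇔
                (lookup (0 ∷ j ∷ π) (φ k) ≤ lookup (0 ∷ j ∷ π) (φ l))
  iso zero             l                = both z≤n z≤n
  iso (suc zero)       zero             = neither (s≤s z≤n) 0<j
  iso (suc zero)       (suc zero)       = both ≤-refl ≤-refl
  iso (suc zero)       (suc (suc zero)) = both (s≤s z≤n) (<⇒≤ j<x)
  iso (suc (suc zero)) zero             = neither (s≤s z≤n) (≤-trans (s≤s z≤n) j<x)
  iso (suc (suc zero)) (suc zero)       = neither (s≤s (s≤s z≤n)) j<x
  iso (suc (suc zero)) (suc (suc zero)) = both ≤-refl ≤-refl

-- The words that are nodes of 𝒯(B₀)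

-- Membership in some Iₙ(B₀), as a property of the word alone.
IsNode : Word → Set
IsNode e = ∃[ n ] e ∈I n [ B₀ ]

isNode-nonempty : ¬ IsNode []
isNode-nonempty (n , (() , _) , _)

isNode-bound : ∀ e → IsNode e → ∀ i → lookup e i ≤ toℕ i
isNode-bound e (_ , (_ , bound) , _) = bound

-- The position i of the prefix e, as a position of e ++ f.
prefixPos : ∀ (e f : Word) → Fin (length e) → Fin (length (e ++ f))
prefixPos (x ∷ e) f zero    = zero
prefixPos (x ∷ e) f (suc i) = suc (prefixPos e f i)

toℕ-prefixPos : ∀ e f i → toℕ (prefixPos e f i) ≡ toℕ i
toℕ-prefixPos (x ∷ e) f zero    = refl
toℕ-prefixPos (x ∷ e) f (suc i) = cong suc (toℕ-prefixPos e f i)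

lookup-prefixPos : ∀ e f i → lookup e i ≡ lookup (e ++ f) (prefixPos e f i)
lookup-prefixPos (x ∷ e) f zero    = refl
lookup-prefixPos (x ∷ e) f (suc i) = lookup-prefixPos e f i

prefix-isNode : ∀ e f → 0 < length e → IsNode (e ++ f) → IsNode e
prefix-isNode e@(_ ∷ e′) f _ (_ , (_ , bound) , ¬100 ∷ ¬012 ∷ []) =
  length e′ , (refl , bound′) ,
  (¬100 ∘ extend (1 ∷ 0 ∷ 0 ∷ [])) ∷ (¬012 ∘ extend (0 ∷ 1 ∷ 2 ∷ [])) ∷ []
  where
  bound′ : ∀ i → lookup e i ≤ toℕ i
  bound′ i = subst₂ _≤_ (sym (lookup-prefixPos e f i)) (toℕ-prefixPos e f i)
                        (bound (prefixPos e f i))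

  extend : ∀ τ → Contains τ e → Contains τ (e ++ f)
  extend τ c@(φ , mono , _) =
    contains-map τ e (e ++ f) c (prefixPos e f) (lookup-prefixPos e f)
      λ i j i<j → subst₂ _<_ (sym (toℕ-prefixPos e f (φ i)))
                             (sym (toℕ-prefixPos e f (φ j))) (mono i j i<j)

lookup-last : ∀ (e : Word) x → Σ (Fin (length (e ∷ʳ x))) λ i →
              toℕ i ≡ length e × lookup (e ∷ʳ x) i ≡ x
lookup-last []      x = zero , refl , refl
lookup-last (_ ∷ e) x with lookup-last e x
... | i , i≡ , x≡ = suc i , cong suc i≡ , x≡

last-bound : ∀ e x → IsNode (e ∷ʳ x) → x ≤ length e
last-bound e x p with lookup-last e x
... | i , i≡ , x≡ = subst₂ _≤_ x≡ i≡ (isNode-bound (e ∷ʳ x) p i)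

-- Prepending a zero: the word already starts with a zero, which the new one
-- only repeats.
0∷-isNode : ∀ e → IsNode e → IsNode (0 ∷ e)
0∷-isNode []      p = ⊥-elim (isNode-nonempty p)
0∷-isNode (x ∷ w) (n , (len , bound) , ¬100 ∷ ¬012 ∷ []) with n≤0⇒n≡0 (bound zero)
... | refl = suc n , (cong suc len , bound′) ,
  (λ c → ¬100 (contains-merge 1 (0 ∷ 0 ∷ []) 0 w 1-once c)) ∷
  (λ c → ¬012 (contains-merge 0 (1 ∷ 2 ∷ []) 0 w 0-once c)) ∷ []
  where
  bound′ : ∀ i → lookup (0 ∷ 0 ∷ w) i ≤ toℕ i
  bound′ zero    = z≤n
  bound′ (suc i) = ≤-trans (bound i) (n≤1+n (toℕ i))

  1-once : ∀ j → 1 ≢ lookup (0 ∷ 0 ∷ []) j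
  1-once zero       ()
  1-once (suc zero) ()

  0-once : ∀ j → 0 ≢ lookup (1 ∷ 2 ∷ []) j
  0-once zero       ()
  0-once (suc zero) ()

-- Removing a zero: since 012 is avoided, no letter of π exceeds j, so
-- the bounds survive the shift as long as j is still preceded by at least j zeros.
tail-isNode : ∀ m j π → 0 < j → j ≤ m →
              IsNode (0 ∷ 0^ m ++ j ∷ π) → IsNode (0^ m ++ j ∷ π)
tail-isNode m j π 0<j j≤m (_ , _ , ¬100 ∷ ¬012 ∷ []) =
  m + length π , (length≡ m , bound m 0 j≤m) ,
  (¬100 ∘ contains-∷ (1 ∷ 0 ∷ 0 ∷ []) 0 (0^ m ++ j ∷ π)) ∷
  (¬012 ∘ contains-∷ (0 ∷ 1 ∷ 2 ∷ []) 0 (0^ m ++ j ∷ π)) ∷ []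
  where
  length≡ : ∀ m → length (0^ m ++ j ∷ π) ≡ suc (m + length π)
  length≡ zero    = refl
  length≡ (suc m) = cong suc (length≡ m)

  prepend : ∀ m → Contains (0 ∷ 1 ∷ 2 ∷ []) (0 ∷ j ∷ π) →
            Contains (0 ∷ 1 ∷ 2 ∷ []) (0 ∷ 0^ m ++ j ∷ π)
  prepend zero    c = c
  prepend (suc m) c = contains-∷ (0 ∷ 1 ∷ 2 ∷ []) 0 (0 ∷ 0^ m ++ j ∷ π) (prepend m c)

  letter≤j : ∀ i → lookup (j ∷ π) i ≤ j
  letter≤j zero = ≤-refl
  letter≤j (suc i) with lookup π i ≤? j
  ... | yes x≤j = x≤j
  ... | no  x≰j = ⊥-elim (¬012 (prepend m (contains-012 j π i 0<j (≰⇒> x≰j))))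

  -- k counts the zeros already passed.
  bound : ∀ m k → j ≤ k + m → ∀ i → lookup (0^ m ++ j ∷ π) i ≤ k + toℕ i
  bound zero    k j≤ i =
    ≤-trans (letter≤j i)
      (≤-trans (≤-trans j≤ (≤-reflexive (+-identityʳ k))) (m≤m+n k (toℕ i)))
  bound (suc m) k j≤ zero    = z≤n
  bound (suc m) k j≤ (suc i) =
    ≤-trans (bound m (suc k) (≤-trans j≤ (≤-reflexive (+-suc k m))) i)
            (≤-reflexive (sym (+-suc k (toℕ i))))

0^∷ʳ0 : ∀ m → 0^ m ∷ʳ 0 ≡ 0^ (suc m)
0^∷ʳ0 zero    = refl
0^∷ʳ0 (suc m) = cong (0 ∷_) (0^∷ʳ0 m)

0^∷ʳ-isNode : ∀ m x → x ≤ m → IsNode (0^ m ∷ʳ x)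
0^∷ʳ-isNode m x x≤m =
  subst (λ k → IsNode (0^ k ∷ʳ x)) (m∸n+n≡m x≤m) (prepend (m ∸ x))
  where
  prepend : ∀ k → IsNode (0^ (k + x) ∷ʳ x)
  prepend zero    = x , 0^mm∈I x
  prepend (suc k) = 0∷-isNode (0^ (k + x) ∷ʳ x) (prepend k)

-- Nodes and their descendants

node-≡ : {v w : Node} → value v ≡ value w → v ≡ w
node-≡ {_ , _} {_ , _} refl = refl

-- The nodes of 𝒯(B₀; v).
Subtree : Node → Set
Subtree v = RawPlaneTree.Node (𝒯 v)

subtree-≡ : ∀ {r : Node} {v w : Subtree r} → value (value v) ≡ value (value w) → v ≡ w
subtree-≡ {r} {v} {w} eq = refine-≡ (node-≡ {value v} {value w} eq)
  where
  refine-≡ : ∀ {v w : Node} {p q} → v ≡ w → _≡_ {A = Subtree r} (v , p) (w , q)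
  refine-≡ refl = refl

ancestor⇒prefix : ∀ {v w} → v AncestorOf w → ∃[ π ] value w ≡ value v ++ π
ancestor⇒prefix {v} ε = [] , sym (++-identityʳ (value v))
ancestor⇒prefix {v} ((x , eq) ◅ rest) with ancestor⇒prefix rest
... | π , eq′ = x ∷ π ,
  trans eq′ (trans (cong (_++ π) eq) (∷ʳ-++ (value v) x π))

0<length-++-∷ : ∀ (e : Word) x π → 0 < length (e ++ x ∷ π)
0<length-++-∷ []      x π = s≤s z≤n
0<length-++-∷ (_ ∷ e) x π = s≤s z≤n

-- The prefixes of a node that end with an additional letter are nodes as well.
∷ʳ-isNode : ∀ e x π {w} → w ≡ e ++ x ∷ π → IsNode w → IsNode (e ∷ʳ x)
∷ʳ-isNode e x π refl p =
  prefix-isNode (e ∷ʳ x) π (0<length-++-∷ e x []) (subst IsNode (sym (∷ʳ-++ e x π)) p)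

prefix⇒ancestor : ∀ v w π → value w ≡ value v ++ π → v AncestorOf w
prefix⇒ancestor v w [] eq =
  subst (v AncestorOf_) (node-≡ {v} {w} (trans (sym (++-identityʳ (value v))) (sym eq))) ε
prefix⇒ancestor v w@(_ , [ p ]) (x ∷ π) eq =
  (x , refl) ◅
  prefix⇒ancestor (value v ∷ʳ x , [ ∷ʳ-isNode (value v) x π eq p ]) w π
    (trans eq (sym (∷ʳ-++ (value v) x π)))

-- Restriction of an isomorphism to the subtrees below corresponding nodes

-- A node of the subtree at u, as a node of the subtree at v.
below : ∀ {v} (u : Subtree v) → Subtree (value u) → Subtree v
below (u , [ vu ]) (w , [ uw ]) = w , [ vu ◅◅ uw ]

to-ancestor : ∀ {v v′} (f : 𝒯 v ≅ 𝒯 v′) (u : Subtree v) (w : Node)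
              (uw : value u AncestorOf w) →
              value (_≅_.to f u) AncestorOf value (_≅_.to f (below u (w , [ uw ])))
to-ancestor f (u , [ vu ]) w ε = ε
to-ancestor f (u , [ vu ]) w (_◅_ {j = u₁} step rest) =
  Equivalence.to (_≅_.to-parent f (u , [ vu ]) (u₁ , [ vu ◅◅ (step ◅ ε) ])) step
  ◅ to-ancestor f (u₁ , [ vu ◅◅ (step ◅ ε) ]) w rest

-- An isomorphism preserves descent, so it maps the subtree at u onto the
-- subtree at the image of u.
restrict : ∀ v v′ (f : 𝒯 v ≅ 𝒯 v′) (u : Subtree v) →
           𝒯 (value u) ≅ 𝒯 (value (_≅_.to f u))
restrict v v′ f u = record
  { bijection  = mk↔ₛ′ to′ from′
      (λ w → subtree-≡ (cong (value ∘ value) (strictlyInverseˡ (below u′ w))))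
      (λ w → subtree-≡ (cong (value ∘ value) (strictlyInverseʳ (below u w))))
  ; to-root    = refl
  ; to-parent  = λ x y → f.to-parent (below u x) (below u y)
  ; to-leftSib = λ x y → f.to-leftSib (below u x) (below u y)
  }
  where
  module f = _≅_ f
  open Inverse f.bijection using (strictlyInverseˡ; strictlyInverseʳ)

  u′ : Subtree v′
  u′ = f.to u

  to′ : Subtree (value u) → Subtree (value u′)
  to′ (w , [ uw ]) =
    value (f.to (below u (w , [ uw ]))) , [ to-ancestor f u w uw ]

  from′ : Subtree (value u′) → Subtree (value u)
  from′ (w , [ u′w ]) =
    value (f.from (below u′ (w , [ u′w ]))) ,
    [ subst (_AncestorOf value (f.from (below u′ (w , [ u′w ]))))
            (cong value (strictlyInverseʳ u))
            (to-ancestor (≅-sym f) u′ w u′w) ]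

-- The subtrees below the children of 0^m

-- The child 0^m x of 0^m; for m = 0 and x = 0 it is the root.
child : (m x : ℕ) → .(x ≤ m) → Node
child m x x≤m = 0^ m ∷ʳ x , [ 0^∷ʳ-isNode m x x≤m ]

drop-isNode : ∀ m j π e → 0 < j → j ≤ m → e ≡ (0^ (suc m) ∷ʳ j) ++ π →
              IsNode e → IsNode (drop 1 e)
drop-isNode m j π e 0<j j≤m refl p =
  subst IsNode (sym (∷ʳ-++ (0^ m) j π))
    (tail-isNode m j π 0<j j≤m
      (subst (λ w → IsNode (0 ∷ w)) (∷ʳ-++ (0^ m) j π) p))

-- The isomorphism prepends a zero.
child-≅-suc : ∀ m j → 0 < j → (j≤m : j ≤ m) .(j≤1+m : j ≤ suc m) →
              𝒯 (child m j j≤m) ≅ 𝒯 (child (suc m) j j≤1+m)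
child-≅-suc m j 0<j j≤m j≤1+m = record
  { bijection  = mk↔ₛ′ grow shrink
      (λ { ((e , _) , [ vw ]) → subtree-≡ (recompute (≡-dec _≟_ _ _) (0∷drop e vw)) })
      (λ _ → subtree-≡ refl)
  ; to-root    = refl
  ; to-parent  = λ v w → mk⇔
      (λ { (x , eq) → x , cong (0 ∷_) eq })
      (λ { (x , eq) → x , ∷-injectiveʳ eq })
  ; to-leftSib = λ v w → mk⇔ (grow-leftSib v w) (shrink-leftSib v w)
  }
  where
  S = child m j j≤m
  T = child (suc m) j j≤1+m

  grow : Subtree S → Subtree T
  grow ((e , [ p ]) , [ Sv ]) = v′ , [ Tv′ (ancestor⇒prefix Sv) ]
    where
    v′ : Node
    v′ = 0 ∷ e , [ 0∷-isNode e p ]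
    Tv′ : ∃[ π ] e ≡ (0^ m ∷ʳ j) ++ π → T AncestorOf v′
    Tv′ (π , eq) = prefix⇒ancestor T v′ π (cong (0 ∷_) eq)

  shrink : Subtree T → Subtree S
  shrink ((e , [ p ]) , [ Tv ]) =
    (drop 1 e , [ isNode′ (ancestor⇒prefix Tv) p ]) ,
    [ prefix⇒ancestor S (drop 1 e , [ isNode′ (ancestor⇒prefix Tv) p ])
        (proj₁ (ancestor⇒prefix Tv)) (cong (drop 1) (proj₂ (ancestor⇒prefix Tv))) ]
    where
    isNode′ : ∃[ π ] e ≡ (0^ (suc m) ∷ʳ j) ++ π → IsNode e → IsNode (drop 1 e)
    isNode′ (π , eq) = drop-isNode m j π e 0<j j≤m eq

  0∷drop : ∀ e {p} → T AncestorOf (e , p) → 0 ∷ drop 1 e ≡ e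
  0∷drop e Tv with ancestor⇒prefix Tv
  ... | π , refl = refl

  -- A descendant of S has at least two letters, as 0 < m, so its parent is not
  -- empty.
  parent-nonempty : ∀ m → 0 < m → ∀ π q x → q ∷ʳ x ≡ (0^ m ∷ʳ j) ++ π → 0 < length q
  parent-nonempty (suc zero)    _ π []      x ()
  parent-nonempty (suc (suc m)) _ π []      x ()
  parent-nonempty (suc m)       _ π (_ ∷ q) x eq = s≤s z≤n

  parent-isNode : ∀ {e p} q x → S AncestorOf (e , p) → e ≡ q ∷ʳ x → IsNode e → IsNode q
  parent-isNode q x Sv refl p with ancestor⇒prefix Sv
  ... | π , eq =
    prefix-isNode q (x ∷ []) (parent-nonempty m (≤-trans 0<j j≤m) π q x eq) p

  grow-leftSib : ∀ v w → RawPlaneTree._LeftSibOf_ (𝒯 S) v w →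
                 RawPlaneTree._LeftSibOf_ (𝒯 T) (grow v) (grow w)
  grow-leftSib v w ((q , [ p ]) , x , y , eqv , eqw , x<y) =
    (0 ∷ q , [ 0∷-isNode q p ]) , x , y , cong (0 ∷_) eqv , cong (0 ∷_) eqw , x<y

  shrink-leftSib : ∀ v w → RawPlaneTree._LeftSibOf_ (𝒯 T) (grow v) (grow w) →
                   RawPlaneTree._LeftSibOf_ (𝒯 S) v w
  shrink-leftSib v w (([] , [ p ]) , _) = ⊥-elim-irr (isNode-nonempty p)
  shrink-leftSib ((e , [ p ]) , [ Sv ]) w ((_ ∷ q , _) , x , y , eqv , eqw , x<y) =
    (q , [ parent-isNode q x Sv (∷-injectiveʳ eqv) p ]) ,
    x , y , ∷-injectiveʳ eqv , ∷-injectiveʳ eqw , x<y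

child-≅ : ∀ m j → 0 < j → (j≤m : j ≤ m) → 𝒯 (child j j ≤-refl) ≅ 𝒯 (child m j j≤m)
child-≅ m j 0<j j≤m = prepend (m ∸ j) m (m∸n+n≡m j≤m) j≤m
  where
  prepend : ∀ k m → k + j ≡ m → .(j≤m : j ≤ m) → 𝒯 (child j j ≤-refl) ≅ 𝒯 (child m j j≤m)
  prepend zero    m refl _   = ≅-refl
  prepend (suc k) m refl j≤m =
    ≅-trans (prepend k (k + j) refl (m≤n+m j k)) (child-≅-suc (k + j) j 0<j (m≤n+m j k) j≤m)

-- The words 0^m represent their classes

parent-bound : ∀ v w x → v ParentOf w by x → x ≤ length (value v)
parent-bound v (_ , [ p ]) x eq =
  recompute (x ≤? length (value v)) (last-bound (value v) x (subst IsNode eq p))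

-- The children of 0^(m+1), from left to right.
childOfZeros : ∀ m → Fin (suc (suc m)) → Subtree (a (suc m))
childOfZeros m i = child (suc m) (toℕ i) (toℕ≤pred[n] i) , [ (toℕ i , refl) ◅ ε ]

childOfZeros-injective : ∀ m i j → childOfZeros m i ≡ childOfZeros m j → i ≡ j
childOfZeros-injective m i j eq =
  toℕ-injective (∷ʳ-injectiveʳ (0^ (suc m)) (0^ (suc m)) (cong (value ∘ value) eq))

-- An isomorphism from the subtree at 0^(m+1) to the subtree at v carries the
-- children of 0^(m+1) to those of v.
module _ (m : ℕ) (v : Node) (f : 𝒯 (a (suc m)) ≅ 𝒯 v) where
  private module f = _≅_ f
  open Inverse f.bijection using (strictlyInverseˡ; strictlyInverseʳ)

  image : Fin (suc (suc m)) → Node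
  image i = value (f.to (childOfZeros m i))

  image-parent : ∀ i → v ParentOf image i
  image-parent i =
    subst (λ r → value r ParentOf image i) f.to-root
      (Equivalence.to (f.to-parent (RawPlaneTree.root (𝒯 (a (suc m)))) (childOfZeros m i))
        (toℕ i , refl))

  image-injective : ∀ i j → image i ≡ image j → i ≡ j
  image-injective i j eq = childOfZeros-injective m i j
    (trans (sym (strictlyInverseʳ (childOfZeros m i)))
      (trans (cong f.from (subtree-≡ (cong value eq)))
             (strictlyInverseʳ (childOfZeros m j))))

  image-surjective : ∀ w → v ParentOf w → ∃[ i ] image i ≡ w
  image-surjective w vw = i , trans (cong (value ∘ f.to) child≡u) (cong value (strictlyInverseˡ w′))
    where
    w′ : Subtree v
    w′ = w , [ vw ◅ ε ]
    u : Subtree (a (suc m))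
    u = f.from w′
    u-parent : a (suc m) ParentOf value u
    u-parent = Equivalence.from (f.to-parent (RawPlaneTree.root (𝒯 (a (suc m)))) u)
      (subst₂ (λ r s → value r ParentOf value s)
              (sym f.to-root) (sym (strictlyInverseˡ w′)) vw)
    x<2+m : proj₁ u-parent < suc (suc m)
    x<2+m = s≤s (≤-trans (parent-bound (a (suc m)) (value u) _ (proj₂ u-parent))
                         (≤-reflexive (length-replicate (suc m))))
    i : Fin (suc (suc m))
    i = fromℕ< x<2+m
    child≡u : childOfZeros m i ≡ u
    child≡u = subtree-≡ (trans (cong (0^ (suc m) ∷ʳ_) (toℕ-fromℕ< x<2+m))
                               (sym (proj₂ u-parent)))

  image-leftSib : ∀ i j → i Fin.< j → image i LeftSibOf image j
  image-leftSib i j i<j =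
    Equivalence.to (f.to-leftSib (childOfZeros m i) (childOfZeros m j))
      (a (suc m) , toℕ i , toℕ j , refl , refl , i<j)

  -- The last letters of the m + 2 children of v are distinct and at most
  -- the length of v.
  length-bound : suc m ≤ length (value v)
  length-bound = s≤s⁻¹ (injective⇒≤ {f = letter} λ {i} {j} → letter-injective i j)
    where
    letter< : ∀ i → proj₁ (image-parent i) < suc (length (value v))
    letter< i = s≤s (parent-bound v (image i) _ (proj₂ (image-parent i)))
    letter : Fin (suc (suc m)) → Fin (suc (length (value v)))
    letter i = fromℕ< (letter< i)
    letter-injective : ∀ i j → letter i ≡ letter j → i ≡ j
    letter-injective i j eq = image-injective i j (node-≡
      (trans (proj₂ (image-parent i))
        (trans (cong (value v ∷ʳ_) (fromℕ<-injective _ _ (letter< i) (letter< j) eq))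
               (sym (proj₂ (image-parent j))))))

first-nonzero : ∀ e → e ≡ 0^ (length e) ⊎ ∃[ i ] ∃[ x ] ∃[ π ] e ≡ 0^ i ++ suc x ∷ π
first-nonzero []          = inj₁ refl
first-nonzero (suc x ∷ π) = inj₂ (0 , x , π , refl)
first-nonzero (zero ∷ e) with first-nonzero e
... | inj₁ eq               = inj₁ (cong (0 ∷_) eq)
... | inj₂ (i , x , π , eq) = inj₂ (suc i , x , π , cong (0 ∷_) eq)

0^-+ : ∀ i k → 0^ (i + k) ≡ 0^ i ++ 0^ k
0^-+ zero    k = refl
0^-+ (suc i) k = cong (0 ∷_) (0^-+ i k)

-- If u is not 0^(m+1), it branches off to the right of 0^(m+1) at its first
-- positive letter.
a-leftmost : ∀ m u → length (value u) ≡ suc m → a (suc m) ≡ u ⊎ a (suc m) LeftOf u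
a-leftmost m u@(e , [ p ]) len with first-nonzero e
... | inj₁ eq = inj₁ (node-≡ (sym (trans eq (cong 0^ len))))
... | inj₂ (zero , x , π , eq) = ⊥-elim-irr (no-node (subst IsNode eq p))
  where
  no-node : ¬ IsNode (suc x ∷ π)
  no-node q with isNode-bound (suc x ∷ π) q zero
  ... | ()
... | inj₂ (suc i , x , π , eq) = inj₂
  ( a (suc (suc i)) , q
  , (a (suc i) , 0 , suc x , sym (0^∷ʳ0 (suc i)) , refl , s≤s z≤n)
  , prefix⇒ancestor (a (suc (suc i))) (a (suc m)) (0^ (length π))
      (trans (cong 0^ 1+m≡) (0^-+ (suc (suc i)) (length π)))
  , prefix⇒ancestor q u π (trans eq (sym (∷ʳ-++ (0^ (suc i)) (suc x) π))) )
  where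
  q : Node
  q = 0^ (suc i) ∷ʳ suc x , [ ∷ʳ-isNode (0^ (suc i)) (suc x) π eq p ]
  1+m≡ : suc m ≡ suc (suc i) + length π
  1+m≡ = trans (sym len) (trans (cong length eq)
    (trans (length-++ (0^ (suc i)))
      (trans (cong (_+ suc (length π)) (length-replicate (suc i)))
             (+-suc (suc i) (length π)))))

-- No node in the class of 0^(m+1) precedes it: the level is bounded below by
-- the number of children, and 0^(m+1) is the left-most node of its level.
a-minimal : ∀ m u → 𝒯 (a (suc m)) ≅ 𝒯 u →
            level (a (suc m)) < level u ⊎
            (level (a (suc m)) ≡ level u × (a (suc m) ≡ u ⊎ a (suc m) LeftOf u))
-- A with-abstraction would normalise the membership proofs inside the type of f.
a-minimal m u f = case m≤n⇒m<n∨m≡n (length-bound m u f) of λ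
  { (inj₁ m<) → inj₁ (subst (_< level u) (sym (length-replicate m)) (pred-mono-≤ m<))
  ; (inj₂ m≡) → inj₂ (trans (length-replicate m) (cong pred m≡) , a-leftmost m u (sym m≡))
  }

≅⇒hasLabel : ∀ m v → 𝒯 (a (suc m)) ≅ 𝒯 v → v HasLabel a (suc m)
≅⇒hasLabel m v f = f , λ u u∼v → a-minimal m u (≅-trans f (≅-sym u∼v))

proposition4p9 : (rootNode HasLabel a 1) ×
    (∀ (m : ℕ) → .{{_ : NonZero m}} → (v : Node) → v HasLabel a m →
    Σ (Fin (suc m) → Node) λ c →
    ChildrenInOrder v c ×
    (c zero HasLabel a (suc m)) ×
    (∀ (j : Fin m) → 𝒯 (c (suc j)) ≅ 𝒯ₘ (suc (toℕ j))))
proposition4p9 = ≅⇒hasLabel 0 rootNode ≅-refl , λ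
  { (suc m) v (f , _) →
      image m v f ,
      (image-parent m v f , image-surjective m v f , image-leftSib m v f) ,
      ≅⇒hasLabel (suc m) (image m v f zero)
        (subst (λ r → 𝒯 r ≅ 𝒯 (image m v f zero)) (node-≡ (0^∷ʳ0 (suc m)))
               (restrict (a (suc m)) v f (childOfZeros m zero))) ,
      λ j → ≅-trans (≅-sym (restrict (a (suc m)) v f (childOfZeros m (suc j))))
                    (≅-sym (child-≅ (suc m) (suc (toℕ j)) (s≤s z≤n) (toℕ≤pred[n] (suc j))))
  }
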